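{- Let $n\ge 1$. If a partial coloring of an $n\times n$ square $A$ with colors from $\{1,2,\dots,2n-2\}$ uniquely extends to $L(n,2n-2)$, then $A$ has at most $\frac{8n}{5}$ uncolored entries.
   Context: An $L(n,k)$ is an $n\times n$ square all of whose entries are colored with colors from a set of $k$ colors so that all entries in a common row, and all entries in a common column, have pairwise different colors. A partial coloring assigns colors (from the $k$ colors) to some entries; the others are uncolored. It uniquely extends to $L(n,k)$ if there is exactly one way to color the uncolored entries so that the resulting fully colored square is an $L(n,k)$. -}

module Defs where

open import Data.Nat using (ℕ; _∸_; _*_)
open import Data.Fin using (Fin)
open import Data.Maybe using (Maybe; just; nothing)
open import Data.List using (List; length; filter)
open import Data.List using (allFin)
open import Data.List using (concatMap; map)
open import Data.Product using (_×_; _,_; ∃)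
open import Relation.Binary.PropositionalEquality using (_≡_)
open import Relation.Nullary.Decidable using (Dec; yes; no)
open import Function.Definitions using (Injective)

Coloring : ℕ → ℕ → Set
Coloring n k = Fin n → Fin n → Fin k

PartialColoring : ℕ → ℕ → Set
PartialColoring n k = Fin n → Fin n → Maybe (Fin k)

IsL : ∀ {n k} → Coloring n k → Set
IsL {n} C =
  (∀ i → Injective _≡_ _≡_ (λ j → C i j)) ×
  (∀ j → Injective _≡_ _≡_ (λ i → C i j))

Extends : ∀ {n k} → PartialColoring n k → Coloring n k → Set
Extends P C = ∀ i j c → P i j ≡ just c → C i j ≡ c

UniquelyExtends : ∀ {n k} → PartialColoring n k → Set
UniquelyExtends P =
  ∃ λ C → IsL C × Extends P C ×
    (∀ C' → IsL C' → Extends P C' → ∀ i j → C' i j ≡ C i j)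

isNothing? : ∀ {A : Set} (m : Maybe A) → Dec (m ≡ nothing)
isNothing? nothing = yes _≡_.refl
isNothing? (just x) = no (λ ())

uncolored : ∀ {n k} → PartialColoring n k → ℕ
uncolored {n} P =
  length (filter (λ ij → isNothing? (P (Data.Product.proj₁ ij) (Data.Product.proj₂ ij)))
    (concatMap (λ i → map (λ j → (i , j)) (allFin n)) (allFin n)))

module Submission where

-- An uncolored cell sees 2n − 2 other cells and cannot be recolored alone, so its row and its
-- column together show all 2n − 2 colors; counting, exactly two of them lie on both lines: the
-- color of the cell and one further color, its mate.  View uncolored cells as edges of the
-- bipartite graph on the 2n lines.  Recoloring a few edges by a swap or a rotation must fail,
-- which makes the mates point along the graph and forces degree at most 2.  Adding the mate
-- equations with alternating signs along a path of 3 or 5 edges restricts the color of the cell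
-- where the two end lines cross; this excludes 4-cycles and paths with 5 edges.  So every
-- component is a path with at most 4 edges, and there are at most (4/5) · 2n edges.

open import Defs
open import Algebra.Properties.CommutativeMonoid.Sum using (sum; ∑-comm; ∑-distrib-+; sum-cong-≗; sum-replicate-zero)
open import Data.Bool using (if_then_else_; true; false)
open import Data.Empty using (⊥; ⊥-elim)
open import Data.Fin as Fin using (Fin; zero; suc; _≟_)
open import Data.Fin.Properties as Fin using (any?)
open import Data.List using (List; []; _∷_; _++_; length; filter; map; concatMap; tabulate; allFin)
open import Data.List.Membership.Propositional using (_∈_; find)
open import Data.List.Properties using (filter-++; length-++; map-tabulate)
open import Data.List.Relation.Unary.All as All using (All; []; _∷_)
open import Data.List.Relation.Unary.AllPairs using (AllPairs; []; _∷_)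
open import Data.List.Relation.Unary.Any as Any using (Any; here; there)
open import Data.Maybe using (nothing)
open import Data.Nat using (ℕ; zero; suc; _+_; _≤_; _*_; _∸_; z≤n; s≤s)
open import Data.Nat.Properties hiding (_≟_)
open import Data.Nat.Solver using (module +-*-Solver)
open import Data.Product using (_×_; _,_; ∃; proj₁; proj₂; swap)
open import Data.Sum using (_⊎_; inj₁; inj₂; [_,_]′; fromInj₁; fromInj₂)
open import Function using (flip; id; _∘_)
open import Relation.Binary.PropositionalEquality
open import Relation.Nullary using (¬_; Dec; yes; no; does; contradiction)
open import Relation.Nullary.Decidable using (_×-dec_; ¬?; dec-true; dec-false)

-- Finite sums of natural numbers and the Kronecker delta.

∑ : ∀ {n} → (Fin n → ℕ) → ℕ
∑ = sum +-0-commutativeMonoid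

∑-const : ∀ n m → ∑ {n} (λ _ → m) ≡ n * m
∑-const zero    m = refl
∑-const (suc n) m = cong (m +_) (∑-const n m)

∑-mono : ∀ {n} {f g : Fin n → ℕ} → (∀ i → f i ≤ g i) → ∑ f ≤ ∑ g
∑-mono {zero}  f≤g = z≤n
∑-mono {suc n} f≤g = +-mono-≤ (f≤g zero) (∑-mono (f≤g ∘ suc))

term≤∑ : ∀ {n} (f : Fin n → ℕ) i → f i ≤ ∑ f
term≤∑ f zero    = m≤m+n _ _
term≤∑ f (suc i) = ≤-trans (term≤∑ (f ∘ suc) i) (m≤n+m _ _)

δ : ∀ {n} → Fin n → Fin n → ℕ
δ a b = if does (a ≟ b) then 1 else 0

δ-≡ : ∀ {n} {a b : Fin n} → a ≡ b → δ a b ≡ 1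
δ-≡ {a = a} {b} a≡b rewrite dec-true (a ≟ b) a≡b = refl

δ-≢ : ∀ {n} {a b : Fin n} → a ≢ b → δ a b ≡ 0
δ-≢ {a = a} {b} a≢b rewrite dec-false (a ≟ b) a≢b = refl

∑-δ : ∀ {n} (a : Fin n) → ∑ (δ a) ≡ 1
∑-δ {suc n} zero    = cong suc (sum-replicate-zero +-0-commutativeMonoid n)
∑-δ {suc n} (suc a) = ∑-δ a

-- Singles out the mate: the one color at which a surplus of total 1 sits.
∑≡1⇒δ : ∀ {n} (f : Fin n → ℕ) → ∑ f ≡ 1 → ∃ λ d → ∀ c → f c ≡ δ d c
∑≡1⇒δ {suc n} f eq with f zero in f₀
... | zero =
  let d , f≗δ = ∑≡1⇒δ (f ∘ suc) eq
  in suc d , λ { zero → f₀ ; (suc c) → f≗δ c }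
... | suc zero = zero , λ
  { zero    → f₀
  ; (suc c) → n≤0⇒n≡0 (subst (f (suc c) ≤_) (suc-injective eq) (term≤∑ (f ∘ suc) c)) }

-- Only the set `U` of free cells is kept from the partial coloring, which makes the notion stable
-- under transposition. `palette` says that `k` is `2n - 2` without truncated subtraction.
record Rigid {n k} (C : Coloring n k) (U : Fin n → Fin n → Set) : Set where
  field
    palette : k + 2 ≡ n + n
    proper  : IsL C
    U?      : ∀ i j → Dec (U i j)
    unique  : ∀ C' → IsL C' → (∀ i j → ¬ U i j → C' i j ≡ C i j) → ∀ i j → C' i j ≡ C i j

transpose : ∀ {n k} {C : Coloring n k} {U : Fin n → Fin n → Set} → Rigid C U → Rigid (flip C) (flip U)
transpose R = record
  { palette = palette
  ; proper  = swap proper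
  ; U?      = flip U?
  ; unique  = λ C' L agree i j → unique (flip C') (swap L) (flip agree) j i
  }
  where open Rigid R

-- Trades, mates and the degree bound for rows.

module Trading {n k} {C : Coloring n k} {U : Fin n → Fin n → Set} (R : Rigid C U) where

  open Rigid R

  row-inj : ∀ {i j j'} → C i j ≡ C i j' → j ≡ j'
  row-inj = proj₁ proper _

  col-inj : ∀ {i i' j} → C i j ≡ C i' j → i ≡ i'
  col-inj = proj₂ proper _

  row-clash : ∀ {A : Set} {i j j'} → j ≢ j' → C i j ≡ C i j' → A
  row-clash j≢j' eq = contradiction (row-inj eq) j≢j'

  col-clash : ∀ {A : Set} {i i' j} → i ≢ i' → C i j ≡ C i' j → A
  col-clash i≢i' eq = contradiction (col-inj eq) i≢i'

  Entry : Set
  Entry = Fin n × Fin n × Fin k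

  Covered : List Entry → Fin n → Fin n → Set
  Covered L i j = Any (λ e → proj₁ e ≡ i × proj₁ (proj₂ e) ≡ j) L

  Compatible : Entry → Entry → Set
  Compatible (i , j , b) (i' , j' , b') = b ≡ b' → i ≢ i' × j ≢ j'

  -- An entry (i , j , b) proposes to recolor the cell (i , j) with b; the present holders of b
  -- on its two lines must then be recolored as well.
  record Admissible (L : List Entry) (e : Entry) : Set where
    constructor adm
    i = proj₁ e
    j = proj₁ (proj₂ e)
    b = proj₂ (proj₂ e)
    field
      free   : U i j
      change : b ≢ C i j
      in-row : ∀ {j'} → C i j' ≡ b → Covered L i j'
      in-col : ∀ {i'} → C i' j ≡ b → Covered L i' j

  compatible : ∀ {L x y} → AllPairs Compatible L → x ∈ L → y ∈ L → x ≡ y ⊎ Compatible x y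
  compatible (_ ∷ _)  (here refl) (here refl) = inj₁ refl
  compatible (p ∷ _)  (here refl) (there y)   = inj₂ (All.lookup p y)
  compatible (p ∷ _)  (there x)   (here refl) =
    inj₂ λ eq → let r , s = All.lookup p x (sym eq) in r ∘ sym , s ∘ sym
  compatible (_ ∷ ps) (there x)   (there y)   = compatible ps x y

  -- Overwriting the listed cells gives another proper coloring: two new colors do not clash by
  -- compatibility, and a new color does not clash with an old one because its old holders on the
  -- two lines are overwritten too. Only free cells change, and the first listed one does change,
  -- against uniqueness.
  trade : ∀ {e L} → AllPairs Compatible (e ∷ L) → All (Admissible (e ∷ L)) (e ∷ L) → ⊥
  trade {e} {es} compat admissible = changed (covered? i₀ j₀)
    (unique C' (row , col) (λ i j → outside (covered? i j)) i₀ j₀)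
    where
    L = e ∷ es
    i₀ = proj₁ e
    j₀ = proj₁ (proj₂ e)

    covered? : ∀ i j → Dec (Covered L i j)
    covered? i j = Any.any? (λ e → (proj₁ e ≟ i) ×-dec (proj₁ (proj₂ e) ≟ j)) L

    -- The decision is an explicit argument so that the clash proofs can split on it directly.
    pick : ∀ i j → Dec (Covered L i j) → Fin k
    pick i j (yes p) = proj₂ (proj₂ (proj₁ (find p)))
    pick i j (no _)  = C i j

    C' : Coloring n k
    C' i j = pick i j (covered? i j)

    row-inj' : ∀ {i j j'} (p : Dec (Covered L i j)) (q : Dec (Covered L i j')) →
               pick i j p ≡ pick i j' q → j ≡ j'
    row-inj' (yes p) (yes q) eq with find p | find q
    ... | x , x∈ , refl , refl | y , y∈ , refl , refl with compatible compat x∈ y∈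
    ... | inj₁ refl = refl
    ... | inj₂ c    = contradiction refl (proj₁ (c eq))
    row-inj' (yes p) (no ¬q) eq with find p
    ... | x , x∈ , refl , refl =
      contradiction (Admissible.in-row (All.lookup admissible x∈) (sym eq)) ¬q
    row-inj' (no ¬p) (yes q) eq with find q
    ... | y , y∈ , refl , refl =
      contradiction (Admissible.in-row (All.lookup admissible y∈) eq) ¬p
    row-inj' (no _) (no _) eq = row-inj eq

    col-inj' : ∀ {i i' j} (p : Dec (Covered L i j)) (q : Dec (Covered L i' j)) →
               pick i j p ≡ pick i' j q → i ≡ i'
    col-inj' (yes p) (yes q) eq with find p | find q
    ... | x , x∈ , refl , refl | y , y∈ , refl , refl with compatible compat x∈ y∈
    ... | inj₁ refl = refl
    ... | inj₂ c    = contradiction refl (proj₂ (c eq))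
    col-inj' (yes p) (no ¬q) eq with find p
    ... | x , x∈ , refl , refl =
      contradiction (Admissible.in-col (All.lookup admissible x∈) (sym eq)) ¬q
    col-inj' (no ¬p) (yes q) eq with find q
    ... | y , y∈ , refl , refl =
      contradiction (Admissible.in-col (All.lookup admissible y∈) eq) ¬p
    col-inj' (no _) (no _) eq = col-inj eq

    row : ∀ i {j j'} → C' i j ≡ C' i j' → j ≡ j'
    row i {j} {j'} = row-inj' (covered? i j) (covered? i j')

    col : ∀ j {i i'} → C' i j ≡ C' i' j → i ≡ i'
    col j {i} {i'} = col-inj' (covered? i j) (covered? i' j)

    outside : ∀ {i j} (p : Dec (Covered L i j)) → ¬ U i j → pick i j p ≡ C i j
    outside (no _)  ¬u = refl
    outside (yes p) ¬u with find p
    ... | x , x∈ , refl , refl = contradiction (Admissible.free (All.lookup admissible x∈)) ¬u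

    changed : (p : Dec (Covered L i₀ j₀)) → pick i₀ j₀ p ≢ C i₀ j₀
    changed (no ¬p) _  = ¬p (here (refl , refl))
    changed (yes p) eq with find p
    ... | x , x∈ , refl , refl = Admissible.change (All.lookup admissible x∈) eq

  ρ : Fin n → Fin k → ℕ
  ρ i c = ∑ λ j → δ (C i j) c

  κ : Fin n → Fin k → ℕ
  κ j c = ∑ λ i → δ (C i j) c

  ρ≥1 : ∀ {i j c} → C i j ≡ c → 1 ≤ ρ i c
  ρ≥1 {i} {j} {c} eq = subst (_≤ ρ i c) (δ-≡ eq) (term≤∑ (λ j → δ (C i j) c) j)

  κ≥1 : ∀ {i j c} → C i j ≡ c → 1 ≤ κ j c
  κ≥1 {i} {j} {c} eq = subst (_≤ κ j c) (δ-≡ eq) (term≤∑ (λ i → δ (C i j) c) i)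

  ∑-ρ : ∀ i → ∑ (ρ i) ≡ n
  ∑-ρ i = begin
    ∑ (ρ i)                          ≡⟨ ∑-comm +-0-commutativeMonoid (λ c j → δ (C i j) c) ⟩
    ∑ (λ j → ∑ (λ c → δ (C i j) c))  ≡⟨ sum-cong-≗ +-0-commutativeMonoid (λ j → ∑-δ (C i j)) ⟩
    ∑ {n} (λ j → 1)                  ≡⟨ ∑-const n 1 ⟩
    n * 1                            ≡⟨ *-identityʳ n ⟩
    n                                ∎
    where open ≡-Reasoning

  ∑-κ : ∀ j → ∑ (κ j) ≡ n
  ∑-κ j = begin
    ∑ (κ j)                          ≡⟨ ∑-comm +-0-commutativeMonoid (λ c i → δ (C i j) c) ⟩
    ∑ (λ i → ∑ (λ c → δ (C i j) c))  ≡⟨ sum-cong-≗ +-0-commutativeMonoid (λ i → ∑-δ (C i j)) ⟩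
    ∑ {n} (λ i → 1)                  ≡⟨ ∑-const n 1 ⟩
    n * 1                            ≡⟨ *-identityʳ n ⟩
    n                                ∎
    where open ≡-Reasoning

  -- Occurrences of `c` on the two lines: one for every color, one more for the color of the cell,
  -- which lies on both lines and is counted twice, and one more for the mate `d`.
  record Mate (i j : Fin n) (d : Fin k) : Set where
    constructor mated
    field
      incidence : ∀ c → ρ i c + κ j c ≡ (1 + δ (C i j) c) + δ d c

  open Mate

  -- A color missing from both lines could be put into the free cell alone, a trade with one entry.
  seen : ∀ {i j} → U i j → ∀ c → 1 + δ (C i j) c ≤ ρ i c + κ j c
  seen {i} {j} u c with C i j ≟ c
  ... | yes eq = +-mono-≤ (ρ≥1 eq) (κ≥1 eq)
  ... | no neq with any? (λ j' → C i j' ≟ c) | any? (λ i' → C i' j ≟ c)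
  ... | yes (_ , eq) | _            = ≤-trans (ρ≥1 eq) (m≤m+n _ _)
  ... | no _         | yes (_ , eq) = ≤-trans (κ≥1 eq) (m≤n+m _ _)
  ... | no ¬row      | no ¬col      = ⊥-elim (trade ([] ∷ [])
    (adm u (neq ∘ sym) (λ eq → contradiction (_ , eq) ¬row) (λ eq → contradiction (_ , eq) ¬col) ∷ []))

  -- Over all colors the counts add up to `n + n`, which is `k + 2`, and the lower bounds of `seen`
  -- to `k + 1`; so the surplus `t` has total 1.
  mate : ∀ {i j} → U i j → ∃ (Mate i j)
  mate {i} {j} u =
    let d , t≗δ = ∑≡1⇒δ t ∑t≡1
    in d , mated λ c → trans (sym (m+[n∸m]≡n (seen u c))) (cong (1 + δ (C i j) c +_) (t≗δ c))
    where
    t : Fin k → ℕ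
    t c = (ρ i c + κ j c) ∸ (1 + δ (C i j) c)

    ∑t≡1 : ∑ t ≡ 1
    ∑t≡1 = +-cancelˡ-≡ (k + 1) _ _ (begin
      k + 1 + ∑ t
        ≡⟨ cong (_+ ∑ t) (cong₂ _+_ (trans (∑-const k 1) (*-identityʳ k)) (∑-δ (C i j))) ⟨
      ∑ {k} (λ _ → 1) + ∑ (δ (C i j)) + ∑ t
        ≡⟨ cong (_+ ∑ t) (∑-distrib-+ +-0-commutativeMonoid (λ _ → 1) (δ (C i j))) ⟨
      ∑ (λ c → 1 + δ (C i j) c) + ∑ t
        ≡⟨ ∑-distrib-+ +-0-commutativeMonoid (λ c → 1 + δ (C i j) c) t ⟨
      ∑ (λ c → 1 + δ (C i j) c + t c)
        ≡⟨ sum-cong-≗ +-0-commutativeMonoid (λ c → m+[n∸m]≡n (seen u c)) ⟩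
      ∑ (λ c → ρ i c + κ j c)
        ≡⟨ ∑-distrib-+ +-0-commutativeMonoid (ρ i) (κ j) ⟩
      ∑ (ρ i) + ∑ (κ j)
        ≡⟨ cong₂ _+_ (∑-ρ i) (∑-κ j) ⟩
      n + n
        ≡⟨ palette ⟨
      k + 2
        ≡⟨ +-assoc k 1 1 ⟨
      k + 1 + 1 ∎)
      where open ≡-Reasoning

  -- Any other color has count 1 on the two lines together, too little for an occurrence on each.
  mate-excl : ∀ {i j d} → Mate i j d → ∀ {i' j' c} → C i j' ≡ c → C i' j ≡ c → C i j ≡ c ⊎ d ≡ c
  mate-excl {i} {j} {d} m {c = c} r s with C i j ≟ c | d ≟ c | incidence m c
  ... | yes p | _     | _  = inj₁ p
  ... | no _  | yes q | _  = inj₂ q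
  ... | no p  | no q  | eq =
    contradiction (≤-trans (+-mono-≤ (ρ≥1 r) (κ≥1 s)) (≤-reflexive eq)) λ { (s≤s ()) }

  -- Otherwise the two cells could exchange colors: a new color already present in the column would
  -- lie on both lines of its cell, hence be its color or its mate.
  swap-row : ∀ {i j j' d d'} → j ≢ j' → U i j → U i j' → Mate i j d → Mate i j' d' →
             d ≡ C i j' ⊎ d' ≡ C i j
  swap-row {i} {j} {j'} {d} {d'} j≢j' u u' m m' with d ≟ C i j' | d' ≟ C i j
  ... | yes p | _     = inj₁ p
  ... | no _  | yes q = inj₂ q
  ... | no p  | no q  = ⊥-elim (trade
    ((row-clash (j≢j' ∘ sym) ∷ []) ∷ [] ∷ [])
    ( adm u (j≢j' ∘ sym ∘ row-inj)
        (λ eq → there (here (refl , sym (row-inj eq))))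
        (λ eq → contradiction (mate-excl m refl eq) [ j≢j' ∘ row-inj , p ]′)
    ∷ adm u' (j≢j' ∘ row-inj)
        (λ eq → here (refl , sym (row-inj eq)))
        (λ eq → contradiction (mate-excl m' refl eq) [ j≢j' ∘ sym ∘ row-inj , q ]′)
    ∷ []))

  -- Each cell takes the color of the previous one in the cycle. Its mate is the color of the next
  -- one, so the color it receives is absent from its column.
  rotate-row : ∀ {i j₁ j₂ j₃ d₁ d₂ d₃} → j₁ ≢ j₂ → j₂ ≢ j₃ → j₃ ≢ j₁ →
    U i j₁ → U i j₂ → U i j₃ → Mate i j₁ d₁ → Mate i j₂ d₂ → Mate i j₃ d₃ →
    d₁ ≡ C i j₂ → d₂ ≡ C i j₃ → d₃ ≡ C i j₁ → ⊥
  rotate-row ne₁₂ ne₂₃ ne₃₁ u₁ u₂ u₃ m₁ m₂ m₃ refl refl refl = trade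
    ((row-clash ne₃₁ ∷ row-clash (ne₂₃ ∘ sym) ∷ []) ∷ (row-clash ne₁₂ ∷ []) ∷ [] ∷ [])
    ( adm u₁ (ne₃₁ ∘ row-inj)
        (λ eq → there (there (here (refl , sym (row-inj eq)))))
        (λ eq → contradiction (mate-excl m₁ refl eq) [ ne₃₁ ∘ sym ∘ row-inj , ne₂₃ ∘ row-inj ]′)
    ∷ adm u₂ (ne₁₂ ∘ row-inj)
        (λ eq → here (refl , sym (row-inj eq)))
        (λ eq → contradiction (mate-excl m₂ refl eq) [ ne₁₂ ∘ sym ∘ row-inj , ne₃₁ ∘ row-inj ]′)
    ∷ adm u₃ (ne₂₃ ∘ row-inj)
        (λ eq → there (here (refl , sym (row-inj eq))))
        (λ eq → contradiction (mate-excl m₃ refl eq) [ ne₂₃ ∘ sym ∘ row-inj , ne₁₂ ∘ row-inj ]′)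
    ∷ [])

  -- `swap-row` directs each of the three pairs. A cell directed to both others would have two
  -- different mates, so the directions form a cycle, which `rotate-row` excludes.
  row-degree≤2 : ∀ {i j₁ j₂ j₃} → j₁ ≢ j₂ → j₂ ≢ j₃ → j₃ ≢ j₁ → U i j₁ → U i j₂ → U i j₃ → ⊥
  row-degree≤2 ne₁₂ ne₂₃ ne₃₁ u₁ u₂ u₃
    with d₁ , m₁ ← mate u₁ | d₂ , m₂ ← mate u₂ | d₃ , m₃ ← mate u₃
    with swap-row ne₁₂ u₁ u₂ m₁ m₂ | swap-row ne₂₃ u₂ u₃ m₂ m₃ | swap-row ne₃₁ u₃ u₁ m₃ m₁
  ... | inj₁ p | inj₁ q | inj₁ r = rotate-row ne₁₂ ne₂₃ ne₃₁ u₁ u₂ u₃ m₁ m₂ m₃ p q r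
  ... | inj₁ p | inj₁ q | inj₂ r = ne₂₃ (row-inj (trans (sym p) r))
  ... | _      | inj₂ q | inj₁ r = ne₁₂ (row-inj (trans (sym r) q))
  ... | inj₂ p | inj₁ q | _      = ne₃₁ (row-inj (trans (sym q) p))
  ... | inj₁ p | inj₂ q | inj₂ r = ne₂₃ (row-inj (trans (sym p) r))
  ... | inj₂ p | inj₂ q | inj₂ r =
    rotate-row (ne₃₁ ∘ sym) (ne₂₃ ∘ sym) (ne₁₂ ∘ sym) u₁ u₃ u₂ m₁ m₃ m₂ r q p

  -- The two outer cells share the color d₂; exchange it with the color of the middle cell.
  pinched-path : ∀ {i₁ i₂ j₁ j₂ d₁ d₂ d₃} → i₁ ≢ i₂ → j₁ ≢ j₂ →
    U i₁ j₁ → U i₂ j₁ → U i₂ j₂ → Mate i₁ j₁ d₁ → Mate i₂ j₁ d₂ → Mate i₂ j₂ d₃ →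
    d₁ ≢ C i₂ j₁ → d₂ ≡ C i₁ j₁ → d₂ ≡ C i₂ j₂ → d₃ ≢ C i₂ j₁ → ⊥
  pinched-path i≢ j≢ u₁ u₂ u₃ m₁ m₂ m₃ d₁≢ refl c₁≡c₃ d₃≢ = trade
    ((col-clash (i≢ ∘ sym) ∷ (λ _ → i≢ , j≢) ∷ []) ∷ (col-clash i≢ ∷ []) ∷ [] ∷ [])
    ( adm u₁ (i≢ ∘ sym ∘ col-inj)
        (λ eq → contradiction (mate-excl m₁ eq refl) [ i≢ ∘ col-inj , d₁≢ ]′)
        (λ eq → there (here (sym (col-inj eq) , refl)))
    ∷ adm u₂ (i≢ ∘ col-inj)
        (λ eq → there (there (here (refl , sym (row-inj (trans eq c₁≡c₃))))))
        (λ eq → here (sym (col-inj eq) , refl))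
    ∷ adm u₃ (j≢ ∘ row-inj)
        (λ eq → there (here (refl , sym (row-inj eq))))
        (λ eq → contradiction (mate-excl m₃ refl eq) [ j≢ ∘ sym ∘ row-inj , d₃≢ ]′)
    ∷ [])

  -- Each mate is the color of the next cell of the 4-cycle, so every cell can take the color of
  -- the previous one (this allows equal colors on a diagonal).
  rotate-square : ∀ {i₁ i₂ j₁ j₂ d₁ d₂ d₃ d₄} → i₁ ≢ i₂ → j₁ ≢ j₂ →
    U i₁ j₁ → U i₂ j₁ → U i₂ j₂ → U i₁ j₂ →
    Mate i₁ j₁ d₁ → Mate i₂ j₁ d₂ → Mate i₂ j₂ d₃ → Mate i₁ j₂ d₄ →
    d₁ ≡ C i₂ j₁ → d₂ ≡ C i₂ j₂ → d₃ ≡ C i₁ j₂ → d₄ ≡ C i₁ j₁ → ⊥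
  rotate-square {i₁} {i₂} {j₁} {j₂} i≢ j≢ u₁ u₂ u₃ u₄ m₁ m₂ m₃ m₄ refl refl refl refl = trade
    ( (row-clash (j≢ ∘ sym) ∷ (λ _ → i≢ , j≢) ∷ col-clash i≢ ∷ [])
    ∷ (col-clash i≢ ∷ (λ _ → i≢ ∘ sym , j≢) ∷ [])
    ∷ (row-clash j≢ ∷ []) ∷ [] ∷ [])
    ( adm u₁ (j≢ ∘ sym ∘ row-inj)
        (λ eq → there (there (there (here (refl , sym (row-inj eq))))))
        (λ eq → [ row-clash j≢ , (λ p → there (here (sym (col-inj (trans eq (sym p))) , refl))) ]′
          (mate-excl m₁ refl eq))
    ∷ adm u₂ (i≢ ∘ col-inj)
        (λ eq → [ col-clash (i≢ ∘ sym) , (λ p → there (there (here (refl , sym (row-inj (trans eq (sym p))))))) ]′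
          (mate-excl m₂ eq refl))
        (λ eq → here (sym (col-inj eq) , refl))
    ∷ adm u₃ (j≢ ∘ row-inj)
        (λ eq → there (here (refl , sym (row-inj eq))))
        (λ eq → [ row-clash (j≢ ∘ sym) , (λ p → there (there (there (here (sym (col-inj (trans eq (sym p))) , refl))))) ]′
          (mate-excl m₃ refl eq))
    ∷ adm u₄ (i≢ ∘ sym ∘ col-inj)
        (λ eq → [ col-clash i≢ , (λ p → here (refl , sym (row-inj (trans eq (sym p))))) ]′
          (mate-excl m₄ eq refl))
        (λ eq → there (there (here (sym (col-inj eq) , refl))))
    ∷ [])

-- Alternating sums along paths; exclusion of squares and of paths with five edges.

module Paths {n k} {C : Coloring n k} {U : Fin n → Fin n → Set} (R : Rigid C U) where

  open Trading R public
  open Mate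
  private module ᵀ = Trading (transpose R)

  mateᵀ : ∀ {i j d} → Mate i j d → ᵀ.Mate j i d
  mateᵀ {i} {j} m = ᵀ.mated λ c → trans (+-comm (κ j c) (ρ i c)) (incidence m c)

  swap-col : ∀ {i i' j d d'} → i ≢ i' → U i j → U i' j → Mate i j d → Mate i' j d' →
             d ≡ C i' j ⊎ d' ≡ C i j
  swap-col i≢i' u u' m m' = ᵀ.swap-row i≢i' u u' (mateᵀ m) (mateᵀ m')

  col-degree≤2 : ∀ {i₁ i₂ i₃ j} → i₁ ≢ i₂ → i₂ ≢ i₃ → i₃ ≢ i₁ → U i₁ j → U i₂ j → U i₃ j → ⊥
  col-degree≤2 = ᵀ.row-degree≤2

  -- The alternating sum of the mate equations along the path i₁ j₁ i₂ j₂, rearranged to avoid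
  -- subtraction.
  path₃-incidence : ∀ {i₁ i₂ j₁ j₂ d₁ d₂ d₃} → Mate i₁ j₁ d₁ → Mate i₂ j₁ d₂ → Mate i₂ j₂ d₃ → ∀ c →
    (ρ i₁ c + κ j₂ c) + (1 + δ (C i₂ j₁) c + δ d₂ c) ≡
    (1 + δ (C i₁ j₁) c + δ d₁ c) + (1 + δ (C i₂ j₂) c + δ d₃ c)
  path₃-incidence {i₁} {i₂} {j₁} {j₂} m₁ m₂ m₃ c = begin
    (ρ i₁ c + κ j₂ c) + _                    ≡⟨ cong (ρ i₁ c + κ j₂ c +_) (incidence m₂ c) ⟨
    (ρ i₁ c + κ j₂ c) + (ρ i₂ c + κ j₁ c)    ≡⟨ exchange (ρ i₁ c) (κ j₂ c) (ρ i₂ c) (κ j₁ c) ⟩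
    (ρ i₁ c + κ j₁ c) + (ρ i₂ c + κ j₂ c)    ≡⟨ cong₂ _+_ (incidence m₁ c) (incidence m₃ c) ⟩
    _ ∎
    where
    open ≡-Reasoning
    open +-*-Solver
    exchange : ∀ a b c d → (a + b) + (c + d) ≡ (a + d) + (c + b)
    exchange = solve 4 (λ a b c d → (a :+ b) :+ (c :+ d) := (a :+ d) :+ (c :+ b)) refl

  -- The color `c` of the cell where the end lines cross occurs on both of them. So in
  -- `path₃-incidence` the two end cells must have `c` as color or mate more often than the middle
  -- cell.
  corner₃ : ∀ {i₁ i₂ j₁ j₂ d₁ d₂ d₃} → Mate i₁ j₁ d₁ → Mate i₂ j₁ d₂ → Mate i₂ j₂ d₃ →
    let c = C i₁ j₂ in
    ¬ δ (C i₁ j₁) c + δ d₁ c + (δ (C i₂ j₂) c + δ d₃ c) ≤ δ (C i₂ j₁) c + δ d₂ c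
  corner₃ {i₁} {i₂} {j₁} {j₂} {d₁} {d₂} {d₃} m₁ m₂ m₃ le = 1+n≰n (begin
    3 + s₂                             ≤⟨ +-monoˡ-≤ (1 + s₂) (+-mono-≤ (ρ≥1 refl) (κ≥1 refl)) ⟩
    (ρ i₁ c + κ j₂ c) + (1 + s₂)       ≡⟨ path₃-incidence m₁ m₂ m₃ c ⟩
    (1 + s₁) + (1 + s₃)                ≡⟨ cong suc (+-suc s₁ s₃) ⟩
    2 + (s₁ + s₃)                      ≤⟨ +-monoʳ-≤ 2 le ⟩
    2 + s₂                             ∎)
    where
    open ≤-Reasoning
    c = C i₁ j₂
    s₁ = δ (C i₁ j₁) c + δ d₁ c
    s₂ = δ (C i₂ j₁) c + δ d₂ c
    s₃ = δ (C i₂ j₂) c + δ d₃ c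

  -- As for `corner₃`, with two more mate equations in the alternating sum: the constants are 4 on
  -- one side and 3 on the other.
  corner₅ : ∀ {i₁ i₂ i₃ j₁ j₂ j₃ d₁ d₂ d₃ d₄ d₅} →
    Mate i₁ j₁ d₁ → Mate i₂ j₁ d₂ → Mate i₂ j₂ d₃ → Mate i₃ j₂ d₄ → Mate i₃ j₃ d₅ →
    let c = C i₁ j₃ in
    ¬ δ (C i₁ j₁) c + δ d₁ c + (δ (C i₂ j₂) c + δ d₃ c) + (δ (C i₃ j₃) c + δ d₅ c)
      ≤ δ (C i₂ j₁) c + δ d₂ c + (δ (C i₃ j₂) c + δ d₄ c)
  corner₅ {i₁} {i₂} {i₃} {j₁} {j₂} {j₃} {d₁} {d₂} {d₃} {d₄} {d₅} m₁ m₂ m₃ m₄ m₅ le = 1+n≰n (begin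
    4 + (s₂ + s₄)
      ≡⟨ solve 2 (λ x y → con 4 :+ (x :+ y) := con 2 :+ ((con 1 :+ x) :+ (con 1 :+ y))) refl s₂ s₄ ⟩
    2 + ((1 + s₂) + (1 + s₄))
      ≤⟨ +-monoˡ-≤ _ (+-mono-≤ (ρ≥1 refl) (κ≥1 refl)) ⟩
    (r₁ + k₃) + ((1 + s₂) + (1 + s₄))
      ≡⟨ cong (λ y → (r₁ + k₃) + ((1 + s₂) + y)) (incidence m₄ c) ⟨
    (r₁ + k₃) + ((1 + s₂) + (r₃ + k₂))
      ≡⟨ solve 5 (λ a b e f x → (a :+ b) :+ (x :+ (e :+ f)) := ((a :+ f) :+ x) :+ (e :+ b)) refl r₁ k₃ r₃ k₂ (1 + s₂) ⟩
    ((r₁ + k₂) + (1 + s₂)) + (r₃ + k₃)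
      ≡⟨ cong₂ _+_ (path₃-incidence m₁ m₂ m₃ c) (incidence m₅ c) ⟩
    (1 + s₁) + (1 + s₃) + (1 + s₅)
      ≡⟨ solve 3 (λ x y z → (con 1 :+ x) :+ (con 1 :+ y) :+ (con 1 :+ z) := con 3 :+ (x :+ y :+ z)) refl s₁ s₃ s₅ ⟩
    3 + (s₁ + s₃ + s₅)
      ≤⟨ +-monoʳ-≤ 3 le ⟩
    3 + (s₂ + s₄) ∎)
    where
    open ≤-Reasoning
    open +-*-Solver
    c = C i₁ j₃
    r₁ = ρ i₁ c
    r₃ = ρ i₃ c
    k₂ = κ j₂ c
    k₃ = κ j₃ c
    s₁ = δ (C i₁ j₁) c + δ d₁ c
    s₂ = δ (C i₂ j₁) c + δ d₂ c
    s₃ = δ (C i₂ j₂) c + δ d₃ c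
    s₄ = δ (C i₃ j₂) c + δ d₄ c
    s₅ = δ (C i₃ j₃) c + δ d₅ c

  -- In `corner₃` the two end colors share a line with the crossing cell and contribute nothing, and
  -- `d₁` cancels against the middle color; only `d₃` can supply the excess.
  corner-last : ∀ {i₁ i₂ j₁ j₂ d₁ d₂ d₃} → i₁ ≢ i₂ → j₁ ≢ j₂ →
    Mate i₁ j₁ d₁ → Mate i₂ j₁ d₂ → Mate i₂ j₂ d₃ → d₁ ≡ C i₂ j₁ → d₃ ≡ C i₁ j₂
  corner-last {i₁} {i₂} {j₁} {j₂} {d₁} {d₂} {d₃} i≢ j≢ m₁ m₂ m₃ refl with d₃ ≟ C i₁ j₂
  ... | yes p = p
  ... | no p  = contradiction bound (corner₃ m₁ m₂ m₃)
    where
    bound : δ (C i₁ j₁) (C i₁ j₂) + δ (C i₂ j₁) (C i₁ j₂) + (δ (C i₂ j₂) (C i₁ j₂) + δ d₃ (C i₁ j₂))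
            ≤ δ (C i₂ j₁) (C i₁ j₂) + δ d₂ (C i₁ j₂)
    bound rewrite δ-≢ (j≢ ∘ row-inj {i₁}) | δ-≢ (i≢ ∘ sym ∘ col-inj {j = j₂}) | δ-≢ p =
      +-monoʳ-≤ (δ (C i₂ j₁) (C i₁ j₂)) z≤n

  -- Mirror image of `corner-last`: now `d₃` cancels and `d₁` supplies the excess.
  corner-first : ∀ {i₁ i₂ j₁ j₂ d₁ d₂ d₃} → i₁ ≢ i₂ → j₁ ≢ j₂ →
    Mate i₁ j₁ d₁ → Mate i₂ j₁ d₂ → Mate i₂ j₂ d₃ → d₃ ≡ C i₂ j₁ → d₁ ≡ C i₁ j₂
  corner-first {i₁} {i₂} {j₁} {j₂} {d₁} {d₂} {d₃} i≢ j≢ m₁ m₂ m₃ refl with d₁ ≟ C i₁ j₂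
  ... | yes p = p
  ... | no p  = contradiction bound (corner₃ m₁ m₂ m₃)
    where
    bound : δ (C i₁ j₁) (C i₁ j₂) + δ d₁ (C i₁ j₂) + (δ (C i₂ j₂) (C i₁ j₂) + δ (C i₂ j₁) (C i₁ j₂))
            ≤ δ (C i₂ j₁) (C i₁ j₂) + δ d₂ (C i₁ j₂)
    bound rewrite δ-≢ (j≢ ∘ row-inj {i₁}) | δ-≢ (i≢ ∘ sym ∘ col-inj {j = j₂}) | δ-≢ p = m≤m+n _ _

  -- If both fail, the two swaps force `d₂` to be the color of both end cells, which is the
  -- situation of `pinched-path`.
  inward : ∀ {i₁ i₂ j₁ j₂ d₁ d₂ d₃} → i₁ ≢ i₂ → j₁ ≢ j₂ →
    U i₁ j₁ → U i₂ j₁ → U i₂ j₂ → Mate i₁ j₁ d₁ → Mate i₂ j₁ d₂ → Mate i₂ j₂ d₃ →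
    d₁ ≡ C i₂ j₁ ⊎ d₃ ≡ C i₂ j₁
  inward {i₂ = i₂} {j₁} {d₁ = d₁} {d₃ = d₃} i≢ j≢ u₁ u₂ u₃ m₁ m₂ m₃
    with d₁ ≟ C i₂ j₁ | d₃ ≟ C i₂ j₁ | swap-col i≢ u₁ u₂ m₁ m₂ | swap-row j≢ u₂ u₃ m₂ m₃
  ... | yes p | _     | _      | _      = inj₁ p
  ... | no _  | yes p | _      | _      = inj₂ p
  ... | no ¬p | _     | inj₁ p | _      = contradiction p ¬p
  ... | _     | no ¬p | _      | inj₂ p = contradiction p ¬p
  ... | no p  | no q  | inj₂ r | inj₁ s = ⊥-elim (pinched-path i≢ j≢ u₁ u₂ u₃ m₁ m₂ m₃ p r s q)

  -- The crossing cell of three consecutive cells is here the fourth one, so the corner lemmas carry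
  -- each direction of a mate over to the opposite side. Every case ends in a full rotation, one way
  -- or the other.
  no-square : ∀ {i₁ i₂ j₁ j₂} → i₁ ≢ i₂ → j₁ ≢ j₂ → U i₁ j₁ → U i₂ j₁ → U i₂ j₂ → ¬ U i₁ j₂
  no-square i≢ j≢ u₁ u₂ u₃ u₄
    with d₁ , m₁ ← mate u₁ | d₂ , m₂ ← mate u₂ | d₃ , m₃ ← mate u₃ | d₄ , m₄ ← mate u₄
    = case
    where
    forward  = rotate-square i≢ j≢ u₁ u₂ u₃ u₄ m₁ m₂ m₃ m₄
    backward = rotate-square i≢ (j≢ ∘ sym) u₄ u₃ u₂ u₁ m₄ m₃ m₂ m₁
    last₁₂₃  = corner-last i≢ j≢ m₁ m₂ m₃
    first₁₂₃ = corner-first i≢ j≢ m₁ m₂ m₃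
    last₄₃₂  = corner-last i≢ (j≢ ∘ sym) m₄ m₃ m₂
    first₄₃₂ = corner-first i≢ (j≢ ∘ sym) m₄ m₃ m₂
    last₂₁₄  = corner-last (i≢ ∘ sym) j≢ m₂ m₁ m₄
    case : ⊥
    case with inward i≢ j≢ u₁ u₂ u₃ m₁ m₂ m₃ | inward i≢ (j≢ ∘ sym) u₄ u₃ u₂ m₄ m₃ m₂
    ... | inj₁ p | inj₂ q = forward p q (last₁₂₃ p) (first₄₃₂ q)
    ... | inj₂ p | inj₁ q = backward q p (last₄₃₂ q) (first₁₂₃ p)
    ... | inj₁ p | inj₁ q =
      [ (λ r → forward p r (last₁₂₃ p) (first₄₃₂ r))
      , (λ r → backward q r (last₄₃₂ q) (first₁₂₃ r)) ]′ (swap-row j≢ u₂ u₃ m₂ m₃)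
    -- In the second branch `q` and `r` give two diagonal cells the same color, which the rotation
    -- tolerates.
    ... | inj₂ p | inj₂ q =
      [ (λ r → forward r q (last₁₂₃ r) (first₄₃₂ q))
      , (λ r → backward (last₂₁₄ r) p r (first₁₂₃ p)) ]′ (swap-col i≢ u₁ u₂ m₁ m₂)

  -- Swaps, `inward` and the corner lemmas leave two patterns of mates: `convergent` if `d₁` is
  -- `c₂`, and `outward` otherwise. Both contradict `corner₅` at the color `w` of the cell where the
  -- end lines cross.
  no-path₅ : ∀ {i₁ i₂ i₃ j₁ j₂ j₃} → i₁ ≢ i₂ → i₂ ≢ i₃ → i₁ ≢ i₃ → j₁ ≢ j₂ → j₂ ≢ j₃ → j₁ ≢ j₃ →
    U i₁ j₁ → U i₂ j₁ → U i₂ j₂ → U i₃ j₂ → ¬ U i₃ j₃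
  no-path₅ {i₁} {i₂} {i₃} {j₁} {j₂} {j₃} i₁≢i₂ i₂≢i₃ i₁≢i₃ j₁≢j₂ j₂≢j₃ j₁≢j₃ u₁ u₂ u₃ u₄ u₅
    with d₁ , m₁ ← mate u₁ | d₂ , m₂ ← mate u₂ | d₃ , m₃ ← mate u₃ | d₄ , m₄ ← mate u₄ | d₅ , m₅ ← mate u₅
    = case
    where
    c₁ = C i₁ j₁
    c₂ = C i₂ j₁
    c₃ = C i₂ j₂
    c₄ = C i₃ j₂
    c₅ = C i₃ j₃
    x = C i₁ j₂
    z = C i₂ j₃
    w = C i₁ j₃

    c₁≢w : c₁ ≢ w
    c₁≢w = j₁≢j₃ ∘ row-inj

    c₅≢w : c₅ ≢ w
    c₅≢w = i₁≢i₃ ∘ sym ∘ col-inj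

    x≢w : x ≢ w
    x≢w = j₂≢j₃ ∘ row-inj

    z≢w : z ≢ w
    z≢w = i₁≢i₂ ∘ sym ∘ col-inj

    -- At `w` the terms of `c₁`, `c₅`, `x` and `z` vanish, since these cells share a line with the
    -- crossing cell; those of `c₂` and `c₃` occur on both sides.
    outward : d₁ ≡ x → d₂ ≡ c₃ → d₃ ≡ c₂ → d₅ ≡ z → ⊥
    outward refl refl refl refl = corner₅ m₁ m₂ m₃ m₄ m₅ bound
      where
      bound : δ c₁ w + δ x w + (δ c₃ w + δ c₂ w) + (δ c₅ w + δ z w)
              ≤ δ c₂ w + δ c₃ w + (δ c₄ w + δ d₄ w)
      bound rewrite δ-≢ c₁≢w | δ-≢ c₅≢w | δ-≢ x≢w | δ-≢ z≢w | +-comm (δ c₂ w) (δ c₃ w) =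
        +-monoʳ-≤ (δ c₃ w + δ c₂ w) z≤n

    convergent : d₁ ≡ c₂ → d₂ ≡ c₃ → d₃ ≡ x → d₅ ≡ c₄ → ⊥
    convergent refl refl refl refl = corner₅ m₁ m₂ m₃ m₄ m₅ bound
      where
      bound : δ c₁ w + δ c₂ w + (δ c₃ w + δ x w) + (δ c₅ w + δ c₄ w)
              ≤ δ c₂ w + δ c₃ w + (δ c₄ w + δ d₄ w)
      bound rewrite δ-≢ c₁≢w | δ-≢ c₅≢w | δ-≢ x≢w | +-identityʳ (δ c₃ w) =
        +-monoʳ-≤ (δ c₂ w + δ c₃ w) (m≤m+n _ _)

    case : ⊥
    case with d₁ ≟ c₂ | swap-col i₁≢i₂ u₁ u₂ m₁ m₂ | inward i₁≢i₂ j₁≢j₂ u₁ u₂ u₃ m₁ m₂ m₃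
    -- Here `d₃` is both `x` and `z`, so it is neither `c₄`, in the column of `x`, nor `c₂`, in the
    -- row of `z`.
    ... | yes p | _ | _ = convergent p
      (fromInj₁ (λ r → row-clash j₁≢j₃ (trans (sym r) d₃≡z)) (swap-row j₁≢j₂ u₂ u₃ m₂ m₃))
      d₃≡x d₅≡c₄
      where
      d₃≡x = corner-last i₁≢i₂ j₁≢j₂ m₁ m₂ m₃ p
      d₅≡c₄ = fromInj₂ (λ r → col-clash i₁≢i₃ (trans (sym d₃≡x) r))
                (inward i₂≢i₃ j₂≢j₃ u₃ u₄ u₅ m₃ m₄ m₅)
      d₃≡z = corner-first i₂≢i₃ j₂≢j₃ m₃ m₄ m₅ d₅≡c₄
    ... | no ¬p | inj₁ p | _      = ¬p p
    ... | no ¬p | _      | inj₁ p = ¬p p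
    ... | no _  | inj₂ q | inj₂ p = outward (corner-first i₁≢i₂ j₁≢j₂ m₁ m₂ m₃ p)
      (fromInj₂ (⊥-elim ∘ d₄≢c₃) (inward (i₂≢i₃ ∘ sym) (j₁≢j₂ ∘ sym) u₄ u₃ u₂ m₄ m₃ m₂))
      p
      (corner-last i₂≢i₃ j₂≢j₃ m₃ m₄ m₅
        (fromInj₁ (⊥-elim ∘ d₄≢c₃) (swap-col i₂≢i₃ u₃ u₄ m₃ m₄)))
      where
      -- Otherwise `corner-last`, read backwards from the fourth cell, makes `d₂` the color of the
      -- cell in row `i₃` and column `j₁`, while `q` makes it that of another cell of this column.
      d₄≢c₃ : d₄ ≢ c₃
      d₄≢c₃ r = i₁≢i₃ (col-inj (trans (sym q)
        (corner-last (i₂≢i₃ ∘ sym) (j₁≢j₂ ∘ sym) m₄ m₃ m₂ r)))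

-- Discharging: sums with few positive terms and the shares sent to the lines.

∑≤-single : ∀ {n} (f : Fin n → ℕ) {b} → (∀ j → f j ≤ b) →
  (∀ {j j'} → j ≢ j' → 1 ≤ f j → ¬ 1 ≤ f j') → ∑ f ≤ b
∑≤-single {zero}  f      bound lone = z≤n
∑≤-single {suc n} f {b}  bound lone with f zero in f₀
... | zero  = ∑≤-single (f ∘ suc) (bound ∘ suc) (λ ne → lone (ne ∘ Fin.suc-injective))
... | suc m = begin
  suc m + ∑ (f ∘ suc)      ≡⟨ cong (suc m +_) (sum-cong-≗ +-0-commutativeMonoid rest≡0) ⟩
  suc m + ∑ {n} (λ _ → 0)  ≡⟨ cong (suc m +_) (sum-replicate-zero +-0-commutativeMonoid n) ⟩
  suc m + 0                ≡⟨ +-identityʳ (suc m) ⟩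
  suc m                    ≡⟨ f₀ ⟨
  f zero                   ≤⟨ bound zero ⟩
  b                        ∎
  where
  open ≤-Reasoning
  rest≡0 : ∀ j → f (suc j) ≡ 0
  rest≡0 j = n<1⇒n≡0 (≰⇒> (lone {zero} (λ ()) (≤-trans (s≤s z≤n) (≤-reflexive (sym f₀)))))

∑≤-pair : ∀ {n} (f : Fin n → ℕ) {b} → (∀ j → f j ≤ b) →
  (∀ {j j'} → j ≢ j' → 1 ≤ f j → 1 ≤ f j' → f j + f j' ≤ b) →
  (∀ {j₁ j₂ j₃} → j₁ ≢ j₂ → j₂ ≢ j₃ → j₃ ≢ j₁ → 1 ≤ f j₁ → 1 ≤ f j₂ → ¬ 1 ≤ f j₃) →
  ∑ f ≤ b
∑≤-pair {zero}  f     bound pair triple = z≤n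
∑≤-pair {suc n} f {b} bound pair triple with 1 ≤? f zero
... | no f₀≱1 = subst (λ m → m + ∑ (f ∘ suc) ≤ b) (sym (n<1⇒n≡0 (≰⇒> f₀≱1)))
  (∑≤-pair (f ∘ suc) (bound ∘ suc) (λ ne → pair (ne ∘ Fin.suc-injective))
    (λ ne₁ ne₂ ne₃ → triple (ne₁ ∘ Fin.suc-injective) (ne₂ ∘ Fin.suc-injective) (ne₃ ∘ Fin.suc-injective)))
... | yes f₀≥1 = subst (f zero + ∑ (f ∘ suc) ≤_) (m+[n∸m]≡n (bound zero))
  (+-monoʳ-≤ (f zero) (∑≤-single (f ∘ suc) rest
    (λ ne → triple (λ ()) (ne ∘ Fin.suc-injective) (λ ()) f₀≥1)))
  where
  rest : ∀ j → f (suc j) ≤ b ∸ f zero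
  rest j with 1 ≤? f (suc j)
  ... | yes p = m+n≤o⇒m≤o∸n (f (suc j)) (pair (λ ()) p f₀≥1)
  ... | no ¬p = ≤-trans (≤-reflexive (n<1⇒n≡0 (≰⇒> ¬p))) z≤n

module Charging {n} {U : Fin n → Fin n → Set} (U? : ∀ i j → Dec (U i j)) where

  RowMate : Fin n → Fin n → Set
  RowMate i j = ∃ λ j' → j' ≢ j × U i j'

  ColMate : Fin n → Fin n → Set
  ColMate i j = ∃ λ i' → i' ≢ i × U i' j

  -- The path through the edge goes on beyond its row vertex by two further edges.
  Extended : Fin n → Fin n → Set
  Extended i j = ∃ λ j' → j' ≢ j × U i j' × ColMate i j'

  rowMate? : ∀ i j → Dec (RowMate i j)
  rowMate? i j = any? λ j' → ¬? (j' ≟ j) ×-dec U? i j'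

  colMate? : ∀ i j → Dec (ColMate i j)
  colMate? i j = any? λ i' → ¬? (i' ≟ i) ×-dec U? i' j

  extended? : ∀ i j → Dec (Extended i j)
  extended? i j = any? λ j' → ¬? (j' ≟ j) ×-dec U? i j' ×-dec colMate? i j'

  -- An edge sends this share, of at least 5 units in all, to its row vertex; on a path with 4 edges
  -- the shares are 4,1 | 3,2 | 2,3 | 1,4, so that each of the 5 vertices gets exactly 4.
  charge : Fin n → Fin n → ℕ
  charge i j with U? i j | rowMate? i j | colMate? i j | extended? i j
  ... | no _  | _     | _     | _     = 0
  ... | yes _ | no _  | _     | _     = 4
  ... | yes _ | yes _ | no _  | _     = 1
  ... | yes _ | yes _ | yes _ | yes _ = 2
  ... | yes _ | yes _ | yes _ | no _  = 3

  charge≤4 : ∀ i j → charge i j ≤ 4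
  charge≤4 i j with U? i j | rowMate? i j | colMate? i j | extended? i j
  ... | no _  | _     | _     | _     = z≤n
  ... | yes _ | no _  | _     | _     = ≤-refl
  ... | yes _ | yes _ | no _  | _     = s≤s z≤n
  ... | yes _ | yes _ | yes _ | yes _ = s≤s (s≤s z≤n)
  ... | yes _ | yes _ | yes _ | no _  = s≤s (s≤s (s≤s z≤n))

  charged⇒U : ∀ {i j} → 1 ≤ charge i j → U i j
  charged⇒U {i} {j} p with U? i j | rowMate? i j | colMate? i j | extended? i j
  ... | yes u | _ | _ | _ = u
  charged⇒U () | no _ | _ | _ | _

  -- A share of 4 is excluded by the partner in the row, and a share of 3 forces the partner to have
  -- no column mate, hence share 1.
  charge-pair : ∀ {i j j'} → j ≢ j' → U i j → U i j' → charge i j + charge i j' ≤ 4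
  charge-pair {i} {j} {j'} j≢j' u u'
    with U? i j | rowMate? i j | colMate? i j | extended? i j
       | U? i j' | rowMate? i j' | colMate? i j' | extended? i j'
  ... | no ¬u | _     | _     | _     | _      | _     | _     | _     = contradiction u ¬u
  ... | _     | no ¬r | _     | _     | _      | _     | _     | _     = contradiction (j' , j≢j' ∘ sym , u') ¬r
  ... | _     | _     | _     | _     | no ¬u  | _     | _     | _     = contradiction u' ¬u
  ... | _     | _     | _     | _     | _      | no ¬r | _     | _     = contradiction (j , j≢j' , u) ¬r
  ... | _     | _     | yes c | _     | _      | _     | _     | no ¬e = contradiction (j , j≢j' , u , c) ¬e
  ... | _     | _     | _     | no ¬e | _      | _     | yes c | _     = contradiction (j' , j≢j' ∘ sym , u' , c) ¬e
  ... | yes _ | yes _ | no _  | _     | yes _  | yes _ | no _  | _     = s≤s (s≤s z≤n)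
  ... | yes _ | yes _ | no _  | _     | yes _  | yes _ | yes _ | yes _ = s≤s (s≤s (s≤s z≤n))
  ... | yes _ | yes _ | no _  | _     | yes _  | yes _ | yes _ | no _  = ≤-refl
  ... | yes _ | yes _ | yes _ | yes _ | yes _  | yes _ | no _  | _     = s≤s (s≤s (s≤s z≤n))
  ... | yes _ | yes _ | yes _ | no _  | yes _  | yes _ | no _  | _     = ≤-refl
  ... | yes _ | yes _ | yes _ | yes _ | yes _  | yes _ | yes _ | yes _ = ≤-refl

  ∑-charge≤4 : (∀ {i j₁ j₂ j₃} → j₁ ≢ j₂ → j₂ ≢ j₃ → j₃ ≢ j₁ → U i j₁ → U i j₂ → ¬ U i j₃) →
    ∀ i → ∑ (charge i) ≤ 4
  ∑-charge≤4 deg≤2 i = ∑≤-pair (charge i) (charge≤4 i)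
    (λ ne p p' → charge-pair ne (charged⇒U p) (charged⇒U p'))
    (λ ne₁ ne₂ ne₃ p₁ p₂ p₃ → deg≤2 ne₁ ne₂ ne₃ (charged⇒U p₁) (charged⇒U p₂) (charged⇒U p₃))

-- Double counting of the charge.

module Counting {n k} {C : Coloring n k} {U : Fin n → Fin n → Set} (R : Rigid C U) where

  open Rigid R using (U?)
  open Paths R
  open Charging U?
  private module ᵀ = Charging (flip U?)

  -- The edge would be the middle of a walk with five edges. A coincidence among its vertices closes
  -- a square; otherwise it is a path.
  not-both-extended : ∀ {i j} → U i j → Extended i j → ᵀ.Extended j i → ⊥
  not-both-extended u (j' , j'≢j , u₂ , i' , i'≢i , u₁) (i'' , i''≢i , u₄ , j'' , j''≢j , u₅)
    with i' ≟ i'' | j' ≟ j''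
  ... | yes refl | _        = no-square i'≢i j'≢j u₁ u₂ u u₄
  ... | no _     | yes refl = no-square (i''≢i ∘ sym) (j'≢j ∘ sym) u u₄ u₅ u₂
  ... | no ne    | no ne'   = no-path₅ i'≢i (i''≢i ∘ sym) ne j'≢j (j''≢j ∘ sym) ne' u₁ u₂ u u₄ u₅

  u : Fin n → Fin n → ℕ
  u i j = if does (U? i j) then 1 else 0

  -- An end edge gets 4 from its free end and at least 1 from the other. An inner edge gets 2 or 3
  -- from each end, and `not-both-extended` rules out 2 from both.
  five≤charge : ∀ i j → 5 * u i j ≤ charge i j + ᵀ.charge j i
  five≤charge i j with U? i j | rowMate? i j | colMate? i j | extended? i j | ᵀ.extended? j i
  ... | no _  | _     | _     | _     | _     = z≤n
  ... | yes _ | no _  | no _  | _     | _     = s≤s (s≤s (s≤s (s≤s (s≤s z≤n))))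
  ... | yes _ | no _  | yes _ | _     | _     = ≤-refl
  ... | yes _ | yes _ | no _  | _     | _     = ≤-refl
  ... | yes v | yes _ | yes _ | yes e | yes f = ⊥-elim (not-both-extended v e f)
  ... | yes _ | yes _ | yes _ | yes _ | no _  = ≤-refl
  ... | yes _ | yes _ | yes _ | no _  | yes _ = ≤-refl
  ... | yes _ | yes _ | yes _ | no _  | no _  = s≤s (s≤s (s≤s (s≤s (s≤s z≤n))))

  five∑∑≤ : 5 * ∑ (λ i → ∑ (u i)) ≤ 8 * n
  five∑∑≤ = begin
    5 * ∑ (λ i → ∑ (u i))
      ≡⟨ *-distribˡ-∑ 5 (λ i → ∑ (u i)) ⟩
    ∑ (λ i → 5 * ∑ (u i))
      ≡⟨ sum-cong-≗ +-0-commutativeMonoid (λ i → *-distribˡ-∑ 5 (u i)) ⟩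
    ∑ (λ i → ∑ (λ j → 5 * u i j))
      ≤⟨ ∑-mono (λ i → ∑-mono (five≤charge i)) ⟩
    ∑ (λ i → ∑ (λ j → charge i j + ᵀ.charge j i))
      ≡⟨ sum-cong-≗ +-0-commutativeMonoid
           (λ i → ∑-distrib-+ +-0-commutativeMonoid (charge i) (λ j → ᵀ.charge j i)) ⟩
    ∑ (λ i → ∑ (charge i) + ∑ (λ j → ᵀ.charge j i))
      ≡⟨ ∑-distrib-+ +-0-commutativeMonoid (λ i → ∑ (charge i)) (λ i → ∑ (λ j → ᵀ.charge j i)) ⟩
    ∑ (λ i → ∑ (charge i)) + ∑ (λ i → ∑ (λ j → ᵀ.charge j i))
      ≡⟨ cong (∑ (λ i → ∑ (charge i)) +_) (∑-comm +-0-commutativeMonoid (flip ᵀ.charge)) ⟩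
    ∑ (λ i → ∑ (charge i)) + ∑ (λ j → ∑ (ᵀ.charge j))
      ≤⟨ +-mono-≤ (∑-mono (∑-charge≤4 row-degree≤2)) (∑-mono (ᵀ.∑-charge≤4 col-degree≤2)) ⟩
    ∑ {n} (λ _ → 4) + ∑ {n} (λ _ → 4)
      ≡⟨ cong₂ _+_ (∑-const n 4) (∑-const n 4) ⟩
    n * 4 + n * 4
      ≡⟨ *-distribˡ-+ n 4 4 ⟨
    n * 8
      ≡⟨ *-comm n 8 ⟩
    8 * n ∎
    where
    open ≤-Reasoning
    *-distribˡ-∑ : ∀ {m} a (f : Fin m → ℕ) → a * ∑ f ≡ ∑ (λ i → a * f i)
    *-distribˡ-∑ {zero}  a f = *-zeroʳ a
    *-distribˡ-∑ {suc m} a f =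
      trans (*-distribˡ-+ a (f zero) _) (cong (a * f zero +_) (*-distribˡ-∑ a (f ∘ suc)))

-- From partial colorings and list lengths to rigid colorings and sums.

length-filter-tabulate : ∀ {A : Set} {Q : A → Set} (Q? : ∀ a → Dec (Q a)) {n} (g : Fin n → A) →
  length (filter Q? (tabulate g)) ≡ ∑ (λ j → if does (Q? (g j)) then 1 else 0)
length-filter-tabulate Q? {zero}  g = refl
length-filter-tabulate Q? {suc n} g with does (Q? (g zero))
... | true  = cong suc (length-filter-tabulate Q? (g ∘ suc))
... | false = length-filter-tabulate Q? (g ∘ suc)

length-filter-concatMap : ∀ {A B : Set} {Q : B → Set} (Q? : ∀ b → Dec (Q b)) {n} (f : A → List B) (g : Fin n → A) →
  length (filter Q? (concatMap f (tabulate g))) ≡ ∑ (λ i → length (filter Q? (f (g i))))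
length-filter-concatMap Q? {zero}  f g = refl
length-filter-concatMap Q? {suc n} f g = begin
  length (filter Q? (f (g zero) ++ concatMap f (tabulate (g ∘ suc))))
    ≡⟨ cong length (filter-++ Q? (f (g zero)) _) ⟩
  length (filter Q? (f (g zero)) ++ filter Q? (concatMap f (tabulate (g ∘ suc))))
    ≡⟨ length-++ (filter Q? (f (g zero))) ⟩
  length (filter Q? (f (g zero))) + length (filter Q? (concatMap f (tabulate (g ∘ suc))))
    ≡⟨ cong (length (filter Q? (f (g zero))) +_) (length-filter-concatMap Q? f (g ∘ suc)) ⟩
  ∑ (λ i → length (filter Q? (f (g i)))) ∎
  where open ≡-Reasoning

uncolored-∑ : ∀ {n k} (P : PartialColoring n k) →
  uncolored P ≡ ∑ (λ i → ∑ (λ j → if does (isNothing? (P i j)) then 1 else 0))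
uncolored-∑ {n} P = trans
  (length-filter-concatMap Q? (λ i → map (i ,_) (allFin n)) id)
  (sum-cong-≗ +-0-commutativeMonoid λ i → trans
    (cong (length ∘ filter Q?) (map-tabulate id (i ,_)))
    (length-filter-tabulate Q? (i ,_)))
  where
  Q? : ∀ ij → Dec (P (proj₁ ij) (proj₂ ij) ≡ nothing)
  Q? ij = isNothing? (P (proj₁ ij) (proj₂ ij))

rigid : ∀ {n} → 1 ≤ n → (P : PartialColoring n (2 * n ∸ 2)) (U : UniquelyExtends P) →
  Rigid (proj₁ U) (λ i j → P i j ≡ nothing)
rigid {n} 1≤n P (C , L , E , uniq) = record
  -- By `1≤n` the subtraction in `2 * n ∸ 2` is exact.
  { palette = trans (m∸n+n≡m (*-monoʳ-≤ 2 1≤n)) (cong (n +_) (+-identityʳ n))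
  ; proper  = L
  ; U?      = λ i j → isNothing? (P i j)
  -- A cell colored by `P` is not free, so agreement with `C` off the free cells makes `C'` an
  -- extension of `P`.
  ; unique  = λ C' L' agree → uniq C' L' λ i j c eq →
      trans (agree i j λ eq' → contradiction (trans (sym eq) eq') λ ()) (E i j c eq)
  }

theorem1 : (n : ℕ) → 1 ≤ n → (P : PartialColoring n (2 * n ∸ 2)) →
    UniquelyExtends P → 5 * uncolored P ≤ 8 * n
theorem1 n 1≤n P U = subst (λ m → 5 * m ≤ 8 * n) (sym (uncolored-∑ P))
  (Counting.five∑∑≤ (rigid 1≤n P U))
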